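{- The logic $\mathsf{iCC}\oplus((p\wedge(p>q))\to q)$ is sound and complete with respect to the class of cautious conditional frames $(X,\le,\mathcal R)$ that additionally satisfy: for all $x\in X$ and upsets $a$, if $x\in a$ then $x\in{\uparrow}R_a[x]$.
   Context: Formulas: $\phi::=p\mid\bot\mid\phi\wedge\phi\mid\phi\vee\phi\mid\phi\to\phi\mid\phi>\phi$, $\top:=\bot\to\bot$. $\mathsf{ICK}\oplus\Gamma$ is the smallest set of formulas containing the axioms of intuitionistic propositional logic, $\Gamma$, $(p>(q\wedge r))\leftrightarrow((p>q)\wedge(p>r))$ and $(p>\top)\leftrightarrow\top$, closed under uniform substitution, modus ponens and: from $\phi\leftrightarrow\psi$ infer $(\phi>\chi)\leftrightarrow(\psi>\chi)$ and $(\chi>\phi)\leftrightarrow(\chi>\psi)$. $\mathsf{iCC}:=\mathsf{ICK}\oplus(p>p)\oplus(((p>q)\wedge((p\wedge q)>r))\to(p>r))\oplus(((p>q)\wedge(p>r))\to((p\wedge q)>r))$. A conditional Kripke frame is $(X,\le,\mathcal R)$, $(X,\le)$ a nonempty preorder, $\mathcal R=\{R_a: a\text{ upset}\}$ such that $x\le yR_az$ implies $xR_aw\le z$ for some $w$; $R_a[x]=\{y:xR_ay\}$, ${\uparrow}S=\{y:\exists s\in S,\ s\le y\}$. It is cautious if for all $x$ and upsets $a,b$: $R_a[x]\subseteq a$, and $R_a[x]\subseteq b\subseteq a$ implies ${\uparrow}R_a[x]={\uparrow}R_b[x]$. Valuations map variables to upsets; intuitionistic Kripke clauses and $x\models\phi>\psi$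 iff every $y$ with $xR_{V(\phi)}y$ satisfies $\psi$. Sound and complete: the logic's members are exactly the formulas valid on all frames in the class. -}

module Defs where

open import Level using (Level; Lift; _⊔_; Setω) renaming (suc to lsuc)
open import Data.Nat using (ℕ)
open import Data.Empty using (⊥)
open import Data.Product using (Σ; ∃; _×_; _,_; proj₁; proj₂)
open import Data.Sum using (_⊎_; inj₁; inj₂)

infixr 6 _∧'_
infixr 5 _∨'_
infixr 4 _⇒_ _▷_

data Formula : Set where
  var  : ℕ → Formula
  ⊥'   : Formula
  _∧'_ : Formula → Formula → Formula
  _∨'_ : Formula → Formula → Formula
  _⇒_  : Formula → Formula → Formula
  _▷_  : Formula → Formula → Formula

⊤' : Formula
⊤' = ⊥' ⇒ ⊥'

_⇔_ : Formula → Formula → Formula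
φ ⇔ ψ = (φ ⇒ ψ) ∧' (ψ ⇒ φ)

sub : (ℕ → Formula) → Formula → Formula
sub σ (var n)  = σ n
sub σ ⊥'       = ⊥'
sub σ (φ ∧' ψ) = sub σ φ ∧' sub σ ψ
sub σ (φ ∨' ψ) = sub σ φ ∨' sub σ ψ
sub σ (φ ⇒ ψ)  = sub σ φ ⇒ sub σ ψ
sub σ (φ ▷ ψ)  = sub σ φ ▷ sub σ ψ

p q r : Formula
p = var 0
q = var 1
r = var 2

data IPCAxiom : Formula → Set where
  K    : IPCAxiom (p ⇒ (q ⇒ p))
  S    : IPCAxiom ((p ⇒ (q ⇒ r)) ⇒ ((p ⇒ q) ⇒ (p ⇒ r)))
  ∧E₁  : IPCAxiom ((p ∧' q) ⇒ p)
  ∧E₂  : IPCAxiom ((p ∧' q) ⇒ q)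
  ∧I   : IPCAxiom (p ⇒ (q ⇒ (p ∧' q)))
  ∨I₁  : IPCAxiom (p ⇒ (p ∨' q))
  ∨I₂  : IPCAxiom (q ⇒ (p ∨' q))
  ∨E   : IPCAxiom ((p ⇒ r) ⇒ ((q ⇒ r) ⇒ ((p ∨' q) ⇒ r)))
  ⊥E   : IPCAxiom (⊥' ⇒ p)

data ICK⊕ (Γ : Formula → Set) : Formula → Set where
  ipc    : ∀ {φ} → IPCAxiom φ → ICK⊕ Γ φ
  extra  : ∀ {φ} → Γ φ → ICK⊕ Γ φ
  C∧     : ICK⊕ Γ ((p ▷ (q ∧' r)) ⇔ ((p ▷ q) ∧' (p ▷ r)))
  C⊤     : ICK⊕ Γ ((p ▷ ⊤') ⇔ ⊤')
  usub   : ∀ {φ} (σ : ℕ → Formula) → ICK⊕ Γ φ → ICK⊕ Γ (sub σ φ)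
  mp     : ∀ {φ ψ} → ICK⊕ Γ (φ ⇒ ψ) → ICK⊕ Γ φ → ICK⊕ Γ ψ
  reAnt  : ∀ {φ ψ} χ → ICK⊕ Γ (φ ⇔ ψ) → ICK⊕ Γ ((φ ▷ χ) ⇔ (ψ ▷ χ))
  reCons : ∀ {φ ψ} χ → ICK⊕ Γ (φ ⇔ ψ) → ICK⊕ Γ ((χ ▷ φ) ⇔ (χ ▷ ψ))

data Ax6p10 : Formula → Set where
  id▷  : Ax6p10 (p ▷ p)
  cut  : Ax6p10 (((p ▷ q) ∧' ((p ∧' q) ▷ r)) ⇒ (p ▷ r))
  cmon : Ax6p10 (((p ▷ q) ∧' (p ▷ r)) ⇒ ((p ∧' q) ▷ r))
  mpC  : Ax6p10 ((p ∧' (p ▷ q)) ⇒ q)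

iCC+MP : Formula → Set
iCC+MP = ICK⊕ Ax6p10

IsUpset : ∀ {ℓ} {X : Set ℓ} → (X → X → Set ℓ) → (X → Set ℓ) → Set ℓ
IsUpset {X = X} _≤_ a = ∀ {x y : X} → x ≤ y → a x → a y

Upset : ∀ {ℓ} (X : Set ℓ) → (X → X → Set ℓ) → Set (lsuc ℓ)
Upset {ℓ} X _≤_ = Σ (X → Set ℓ) (IsUpset _≤_)

record Frame (ℓ : Level) : Set (lsuc ℓ) where
  field
    Carrier : Set ℓ
    point   : Carrier                      -- nonempty
    _≤_     : Carrier → Carrier → Set ℓ
    ≤-refl  : ∀ x → x ≤ x
    ≤-trans : ∀ {x y z} → x ≤ y → y ≤ z → x ≤ z
    R       : Upset Carrier _≤_ → Carrier → Carrier → Set ℓ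
    -- R_a depends only on the upset a as a set (Agda has no extensional sets)
    R-ext   : ∀ (a b : Upset Carrier _≤_) →
              (∀ x → proj₁ a x → proj₁ b x) → (∀ x → proj₁ b x → proj₁ a x) →
              ∀ x y → R a x y → R b x y
    R-back  : ∀ (a : Upset Carrier _≤_) {x y z} → x ≤ y → R a y z →
              ∃ λ w → R a x w × w ≤ z

module _ {ℓ} (F : Frame ℓ) where
  open Frame F

  _∈↑R[_]_ : Carrier → Upset Carrier _≤_ → Carrier → Set ℓ
  y ∈↑R[ a ] x = ∃ λ s → R a x s × s ≤ y

  Cautious : Set (lsuc ℓ)
  Cautious =
    (∀ (a : Upset Carrier _≤_) x y → R a x y → proj₁ a y) ×
    (∀ (a b : Upset Carrier _≤_) x →
       (∀ y → R a x y → proj₁ b y) → (∀ y → proj₁ b y → proj₁ a y) →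
       (∀ y → y ∈↑R[ a ] x → y ∈↑R[ b ] x) × (∀ y → y ∈↑R[ b ] x → y ∈↑R[ a ] x))

  CentringUp : Set (lsuc ℓ)
  CentringUp = ∀ (a : Upset Carrier _≤_) x → proj₁ a x → x ∈↑R[ a ] x

  Valuation : Set (lsuc ℓ)
  Valuation = ℕ → Upset Carrier _≤_

  mutual
    sat : Valuation → Formula → Carrier → Set ℓ
    sat V (var n)  x = proj₁ (V n) x
    sat V ⊥'       x = Lift ℓ ⊥
    sat V (φ ∧' ψ) x = sat V φ x × sat V ψ x
    sat V (φ ∨' ψ) x = sat V φ x ⊎ sat V ψ x
    sat V (φ ⇒ ψ)  x = ∀ y → x ≤ y → sat V φ y → sat V ψ y
    sat V (φ ▷ ψ)  x = ∀ y → R (truth V φ) x y → sat V ψ y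

    sat-mono : ∀ V φ → IsUpset _≤_ (sat V φ)
    sat-mono V (var n)  le h = proj₂ (V n) le h
    sat-mono V ⊥'       le h = h
    sat-mono V (φ ∧' ψ) le (h₁ , h₂) = sat-mono V φ le h₁ , sat-mono V ψ le h₂
    sat-mono V (φ ∨' ψ) le (inj₁ h) = inj₁ (sat-mono V φ le h)
    sat-mono V (φ ∨' ψ) le (inj₂ h) = inj₂ (sat-mono V ψ le h)
    sat-mono V (φ ⇒ ψ)  le h z y≤z hz = h z (≤-trans le y≤z) hz
    sat-mono V (φ ▷ ψ)  le h z yRz with R-back (truth V φ) le yRz
    ... | w , xRw , w≤z = sat-mono V ψ w≤z (h w xRw)

    truth : Valuation → Formula → Upset Carrier _≤_
    truth V φ = sat V φ , sat-mono V φ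

  ValidOn : Formula → Set (lsuc ℓ)
  ValidOn φ = ∀ (V : Valuation) x → sat V φ x

ValidClass : ∀ ℓ → Formula → Set (lsuc ℓ)
ValidClass ℓ φ = ∀ (F : Frame ℓ) → Cautious F → CentringUp F → ValidOn F φ

record SoundAndComplete (L : Formula → Set) : Setω where
  field
    sound    : ∀ {φ} → L φ → ∀ ℓ → ValidClass ℓ φ
    complete : ∀ {φ} → (∀ ℓ → ValidClass ℓ φ) → L φ

{-# OPTIONS --safe #-}

-- Soundness is a direct check.  For completeness let Φ be the set of
-- subformulas of φ and Ψ = Φ ∪ {α ▷ β : α, β ∈ Φ}.  Start from all splittings
-- of Ψ into a part declared true and a part declared false, and repeatedly
-- discard a splitting whose true part provably entails the disjunction of its
-- false part.  By cuts on the members of Ψ, what holds in all remaining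
-- splittings is provable; so either φ is provable, or some remaining splitting
-- declares it false, and then the remaining splittings form a countermodel.
-- There Sel x α = {y : α ▷ β ∈ x implies β ∈ y} is prescribed for α ∈ Φ only,
-- and for an arbitrary upset a one takes
--   R_a[x] = {y ∈ a : y ∈ Sel x α for all α ∈ Φ with Sel x α ⊆ a ⊆ [α]}.
-- All α allowed here are equivalent at x by cut and cautious monotonicity.
module Submission where

open import Defs
open import Level using (0ℓ; lower)
open import Data.Empty using (⊥-elim)
open import Data.List.Base using (List; []; _∷_; [_]; _++_; map; length; filter; cartesianProductWith)
open import Data.List.Membership.Propositional using (_∈_; lose; find)
open import Data.List.Membership.Propositional.Properties
  using (∈-map⁺; ∈-map⁻; ∈-++⁺ˡ; ∈-++⁺ʳ; ∈-++⁻; ∈-filter⁺; ∈-filter⁻; ∈-cartesianProductWith⁺)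
open import Data.List.Relation.Binary.Subset.Propositional using (_⊆_)
open import Data.List.Relation.Binary.Subset.Propositional.Properties using (⊆-trans; ∷⁺ʳ; xs⊆x∷xs)
open import Data.List.Relation.Unary.All as All using (All; []; _∷_; all?)
open import Data.List.Relation.Unary.Any using (Any; here; there; any?; _─_)
open import Data.List.Relation.Unary.Any.Properties using (¬Any[])
open import Data.Nat using (ℕ; zero; suc; _≤_; s≤s⁻¹)
open import Data.Nat.Properties as ℕ using ()
open import Data.Product using (∃; _×_; _,_; proj₁; proj₂)
open import Data.Sum using (_⊎_; inj₁; inj₂; [_,_]′; map₁; map₂)
open import Data.Unit using (⊤)
open import Function.Base using (_∘_; id; const)
open import Relation.Binary.PropositionalEquality using (_≡_; refl; cong; subst)
open import Relation.Nullary using (¬_; Dec; yes; no; contradiction)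
open import Relation.Nullary.Decidable using (map′; _×-dec_; ¬?; decidable-stable)

-- Soundness

module _ {ℓ} (F : Frame ℓ) where
  open Frame F renaming (_≤_ to _≼_)

  -- The substitution lemma, with `σ` absorbed into the valuation. Both directions go through one
  -- induction because at `▷` the two antecedents must have equal truth sets before `R-ext` can
  -- exchange their relations.
  sat-sub : ∀ V σ φ x →
            (sat F V (sub σ φ) x → sat F (truth F V ∘ σ) φ x) ×
            (sat F (truth F V ∘ σ) φ x → sat F V (sub σ φ) x)
  sat-sub V σ (var n) x = id , id
  sat-sub V σ ⊥' x = id , id
  sat-sub V σ (φ ∧' ψ) x =
    (λ (a , b) → proj₁ (sat-sub V σ φ x) a , proj₁ (sat-sub V σ ψ x) b) ,
    (λ (a , b) → proj₂ (sat-sub V σ φ x) a , proj₂ (sat-sub V σ ψ x) b)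
  sat-sub V σ (φ ∨' ψ) x =
    [ inj₁ ∘ proj₁ (sat-sub V σ φ x) , inj₂ ∘ proj₁ (sat-sub V σ ψ x) ]′ ,
    [ inj₁ ∘ proj₂ (sat-sub V σ φ x) , inj₂ ∘ proj₂ (sat-sub V σ ψ x) ]′
  sat-sub V σ (φ ⇒ ψ) x =
    (λ h y x≼y a → proj₁ (sat-sub V σ ψ y) (h y x≼y (proj₂ (sat-sub V σ φ y) a))) ,
    (λ h y x≼y a → proj₂ (sat-sub V σ ψ y) (h y x≼y (proj₁ (sat-sub V σ φ y) a)))
  sat-sub V σ (φ ▷ ψ) x =
    (λ h y xRy → proj₁ (sat-sub V σ ψ y)
       (h y (R-ext (truth F (truth F V ∘ σ) φ) (truth F V (sub σ φ))
         (λ z → proj₂ (sat-sub V σ φ z)) (λ z → proj₁ (sat-sub V σ φ z)) x y xRy))) ,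
    (λ h y xRy → proj₂ (sat-sub V σ ψ y)
       (h y (R-ext (truth F V (sub σ φ)) (truth F (truth F V ∘ σ) φ)
         (λ z → proj₁ (sat-sub V σ φ z)) (λ z → proj₂ (sat-sub V σ φ z)) x y xRy)))

  valid-ipc : ∀ {φ} → IPCAxiom φ → ValidOn F φ
  valid-ipc K V x y _ hp z y≼z _ = sat-mono F V p y≼z hp
  valid-ipc S V x y _ pqr z y≼z pq w z≼w hp =
    pqr w (≤-trans y≼z z≼w) hp w (≤-refl w) (pq w z≼w hp)
  valid-ipc ∧E₁ V x y _ = proj₁
  valid-ipc ∧E₂ V x y _ = proj₂
  valid-ipc ∧I V x y _ hp z y≼z hq = sat-mono F V p y≼z hp , hq
  valid-ipc ∨I₁ V x y _ = inj₁
  valid-ipc ∨I₂ V x y _ = inj₂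
  valid-ipc ∨E V x y _ pr z y≼z qr w z≼w = [ pr w (≤-trans y≼z z≼w) , qr w z≼w ]′
  valid-ipc ⊥E V x y _ h = ⊥-elim (lower h)

  module _ (cautious : Cautious F) (centring : CentringUp F) where

    -- At `x`, `φ ▷ ψ` together with `R_a[x] ⊆ a` puts `R_a[x]` inside `b ⊆ a`, so cautiousness
    -- applies. The inclusion into `↑R_b[x]` validates `cut`, the converse one `cmon`.
    ↑R-conjunction : ∀ V x {φ ψ} → sat F V (φ ▷ ψ) x →
      let a = truth F V φ ; b = truth F V (φ ∧' ψ) in
      (∀ y → _∈↑R[_]_ F y a x → _∈↑R[_]_ F y b x) × (∀ y → _∈↑R[_]_ F y b x → _∈↑R[_]_ F y a x)
    ↑R-conjunction V x {φ} {ψ} φ▷ψ = proj₂ cautious (truth F V φ) (truth F V (φ ∧' ψ)) x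
      (λ y xRy → proj₁ cautious (truth F V φ) x y xRy , φ▷ψ y xRy) (λ _ → proj₁)

    valid-Ax : ∀ {φ} → Ax6p10 φ → ValidOn F φ
    valid-Ax id▷ V x = proj₁ cautious (V 0) x
    valid-Ax cut V x y _ (pq , pqr) z yRz =
      let s , yRs , s≼z = proj₁ (↑R-conjunction V y {p} {q} pq) z (z , yRz , ≤-refl z)
      in sat-mono F V r s≼z (pqr s yRs)
    valid-Ax cmon V x y _ (pq , pr) z yRz =
      let s , yRs , s≼z = proj₂ (↑R-conjunction V y {p} {q} pq) z (z , yRz , ≤-refl z)
      in sat-mono F V r s≼z (pr s yRs)
    valid-Ax mpC V x y _ (hp , pq) =
      let s , yRs , s≼y = centring (truth F V p) y hp in sat-mono F V q s≼y (pq s yRs)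

    soundness : ∀ {φ} → iCC+MP φ → ValidOn F φ
    soundness (ipc a) = valid-ipc a
    soundness (extra a) = valid-Ax a
    soundness C∧ V x =
      (λ y _ h → (λ z yRz → proj₁ (h z yRz)) , (λ z yRz → proj₂ (h z yRz))) ,
      (λ y _ (g , h) z yRz → g z yRz , h z yRz)
    soundness C⊤ V x = (λ _ _ _ _ _ → id) , (λ _ _ _ _ _ _ _ → id)
    soundness (usub {φ} σ d) V x = proj₂ (sat-sub V σ φ x) (soundness d (truth F V ∘ σ) x)
    soundness (mp d e) V x = soundness d V x x (≤-refl x) (soundness e V x)
    soundness (reAnt {φ} {ψ} χ d) V x =
      (λ y _ h z yRz → h z (R-ext (truth F V ψ) (truth F V φ) ψ→φ φ→ψ y z yRz)) ,
      (λ y _ h z yRz → h z (R-ext (truth F V φ) (truth F V ψ) φ→ψ ψ→φ y z yRz))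
      where
      φ→ψ : ∀ w → sat F V φ w → sat F V ψ w
      φ→ψ w = proj₁ (soundness d V w) w (≤-refl w)
      ψ→φ : ∀ w → sat F V ψ w → sat F V φ w
      ψ→φ w = proj₂ (soundness d V w) w (≤-refl w)
    soundness (reCons χ d) V x =
      (λ y _ h z yRz → proj₁ (soundness d V z) z (≤-refl z) (h z yRz)) ,
      (λ y _ h z yRz → proj₂ (soundness d V z) z (≤-refl z) (h z yRz))

-- Derivability from hypotheses

infix 3 _⊢_ _⊢ₘ_

-- Theorems enter as closed leaves, so substitution and the congruence rules never act on
-- hypotheses. This is what makes the deduction theorem hold.
data _⊢_ (Γ : List Formula) : Formula → Set where
  hyp : ∀ {φ} → φ ∈ Γ → Γ ⊢ φ
  thm : ∀ {φ} → iCC+MP φ → Γ ⊢ φ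
  _·_ : ∀ {φ ψ} → Γ ⊢ φ ⇒ ψ → Γ ⊢ φ → Γ ⊢ ψ

infixl 5 _·_

pattern #0 = here refl
pattern #1 = there (here refl)
pattern #2 = there (there (here refl))

inst : Formula → Formula → Formula → ℕ → Formula
inst α β γ 0 = α
inst α β γ 1 = β
inst α β γ _ = γ

module _ {Γ : List Formula} where

  axiomⁱ : ∀ α β γ {φ} → IPCAxiom φ → Γ ⊢ sub (inst α β γ) φ
  axiomⁱ α β γ a = thm (usub (inst α β γ) (ipc a))

  axiomᶜ : ∀ α β γ {φ} → Ax6p10 φ → Γ ⊢ sub (inst α β γ) φ
  axiomᶜ α β γ a = thm (usub (inst α β γ) (extra a))

  ∧-intro : ∀ {α β} → Γ ⊢ α → Γ ⊢ β → Γ ⊢ α ∧' β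
  ∧-intro {α} {β} a b = axiomⁱ α β β ∧I · a · b

  ∧-elimˡ : ∀ {α β} → Γ ⊢ α ∧' β → Γ ⊢ α
  ∧-elimˡ {α} {β} h = axiomⁱ α β β ∧E₁ · h

  ∧-elimʳ : ∀ {α β} → Γ ⊢ α ∧' β → Γ ⊢ β
  ∧-elimʳ {α} {β} h = axiomⁱ α β β ∧E₂ · h

weaken : ∀ {Γ Δ φ} → Γ ⊆ Δ → Γ ⊢ φ → Δ ⊢ φ
weaken s (hyp i) = hyp (s i)
weaken s (thm d) = thm d
weaken s (d · e) = weaken s d · weaken s e

deduction : ∀ {Γ φ ψ} → φ ∷ Γ ⊢ ψ → Γ ⊢ φ ⇒ ψ
deduction {φ = φ} (hyp #0) = axiomⁱ φ (φ ⇒ φ) φ S · axiomⁱ φ (φ ⇒ φ) φ K · axiomⁱ φ φ φ K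
deduction {φ = φ} {ψ} (hyp (there i)) = axiomⁱ ψ φ φ K · hyp i
deduction {φ = φ} {ψ} (thm d) = axiomⁱ ψ φ φ K · thm d
deduction {φ = φ} {ψ} (_·_ {χ} d e) = axiomⁱ φ χ ψ S · deduction d · deduction e

[]⊢⇒theorem : ∀ {φ} → [] ⊢ φ → iCC+MP φ
[]⊢⇒theorem (thm d) = d
[]⊢⇒theorem (d · e) = mp ([]⊢⇒theorem d) ([]⊢⇒theorem e)

⇔-theorem : ∀ {φ ψ} → [ φ ] ⊢ ψ → [ ψ ] ⊢ φ → iCC+MP (φ ⇔ ψ)
⇔-theorem d e = []⊢⇒theorem (∧-intro (deduction d) (deduction e))

module _ {Γ : List Formula} where

  ▷-∧ : ∀ {φ α β} → Γ ⊢ φ ▷ α → Γ ⊢ φ ▷ β → Γ ⊢ φ ▷ (α ∧' β)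
  ▷-∧ {φ} {α} {β} a b = ∧-elimʳ (thm (usub (inst φ α β) C∧)) · ∧-intro a b

  -- If `α` entails `β`, then `α` is equivalent to `α ∧' β`, and `C∧` distributes the conditional
  -- over that conjunction.
  ▷-mono : ∀ {φ α β} → [ α ] ⊢ β → Γ ⊢ φ ▷ α → Γ ⊢ φ ▷ β
  ▷-mono {φ} {α} {β} d a =
    ∧-elimʳ (∧-elimˡ (thm (usub (inst φ α β) C∧)) · (∧-elimˡ (thm (reCons φ α⇔α∧β)) · a))
    where
    α⇔α∧β : iCC+MP (α ⇔ (α ∧' β))
    α⇔α∧β = ⇔-theorem (∧-intro (hyp #0) d) (∧-elimˡ (hyp #0))

  ▷-theorem : ∀ {φ α} → [] ⊢ α → Γ ⊢ φ ▷ α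
  ▷-theorem {φ} d =
    ▷-mono (weaken (λ ()) d) (∧-elimʳ (thm (usub (inst φ φ φ) C⊤)) · deduction (hyp #0))

  ▷-closed : ∀ {φ} Δ {α} → (∀ {δ} → δ ∈ Δ → Γ ⊢ φ ▷ δ) → Δ ⊢ α → Γ ⊢ φ ▷ α
  ▷-closed [] h d = ▷-theorem d
  ▷-closed (δ ∷ Δ) h d =
    -- Discharging `δ` makes the induction hypothesis give `φ ▷ (δ ⇒ α)`; combined with `φ ▷ δ`,
    -- modus ponens takes place in the consequent.
    ▷-mono (∧-elimˡ (hyp #0) · ∧-elimʳ (hyp #0)) (▷-∧ (▷-closed Δ (h ∘ there) (deduction d)) (h #0))

  -- Cautious monotonicity strengthens the antecedent of `φ ▷ χ` to `φ ∧' ψ`; after a swap of the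
  -- conjuncts, `cut` with `ψ ▷ φ` removes `φ` again.
  ▷-reciprocity : ∀ {φ ψ χ} → Γ ⊢ φ ▷ ψ → Γ ⊢ ψ ▷ φ → Γ ⊢ φ ▷ χ → Γ ⊢ ψ ▷ χ
  ▷-reciprocity {φ} {ψ} {χ} φψ ψφ φχ =
    axiomᶜ ψ φ χ cut · ∧-intro ψφ (∧-elimˡ (thm (reAnt χ ∧-swap)) · (axiomᶜ φ ψ χ cmon · ∧-intro φψ φχ))
    where
    ∧-swap : iCC+MP ((φ ∧' ψ) ⇔ (ψ ∧' φ))
    ∧-swap = ⇔-theorem (∧-intro (∧-elimʳ (hyp #0)) (∧-elimˡ (hyp #0)))
                       (∧-intro (∧-elimʳ (hyp #0)) (∧-elimˡ (hyp #0)))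

-- Γ ⊢ₘ Δ is derivability of the disjunction of Δ, expressed through its
-- elimination rule.
_⊢ₘ_ : List Formula → List Formula → Set
Γ ⊢ₘ Δ = ∀ Γ′ χ → Γ ⊆ Γ′ → (∀ {δ} → δ ∈ Δ → δ ∷ Γ′ ⊢ χ) → Γ′ ⊢ χ

⊢⇒⊢ₘ : ∀ {Γ Δ δ} → δ ∈ Δ → Γ ⊢ δ → Γ ⊢ₘ Δ
⊢⇒⊢ₘ i d _ _ s k = deduction (k i) · weaken s d

⊢ₘ-mono : ∀ {Γ Γ′ Δ Δ′} → Γ ⊆ Γ′ → Δ ⊆ Δ′ → Γ ⊢ₘ Δ → Γ′ ⊢ₘ Δ′
⊢ₘ-mono s t d Γ″ χ u k = d Γ″ χ (⊆-trans s u) (k ∘ t)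

∨-⊢ₘ : ∀ {φ ψ} → [ φ ∨' ψ ] ⊢ₘ φ ∷ ψ ∷ []
∨-⊢ₘ {φ} {ψ} _ χ s k = axiomⁱ φ ψ χ ∨E · deduction (k #0) · deduction (k #1) · hyp (s #0)

⊥-⊢ₘ : [ ⊥' ] ⊢ₘ []
⊥-⊢ₘ _ χ s _ = axiomⁱ χ χ χ ⊥E · hyp (s #0)

-- Splittings of a list of formulas

infix 4 _≟_

_≟_ : (φ ψ : Formula) → Dec (φ ≡ ψ)
var m ≟ var n = map′ (cong var) (λ { refl → refl }) (m ℕ.≟ n)
var _ ≟ ⊥' = no λ ()
var _ ≟ (_ ∧' _) = no λ ()
var _ ≟ (_ ∨' _) = no λ ()
var _ ≟ (_ ⇒ _) = no λ ()
var _ ≟ (_ ▷ _) = no λ ()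
⊥' ≟ var _ = no λ ()
⊥' ≟ ⊥' = yes refl
⊥' ≟ (_ ∧' _) = no λ ()
⊥' ≟ (_ ∨' _) = no λ ()
⊥' ≟ (_ ⇒ _) = no λ ()
⊥' ≟ (_ ▷ _) = no λ ()
(_ ∧' _) ≟ var _ = no λ ()
(_ ∧' _) ≟ ⊥' = no λ ()
(a ∧' b) ≟ (c ∧' d) = map′ (λ { (refl , refl) → refl }) (λ { refl → refl , refl }) (a ≟ c ×-dec b ≟ d)
(_ ∧' _) ≟ (_ ∨' _) = no λ ()
(_ ∧' _) ≟ (_ ⇒ _) = no λ ()
(_ ∧' _) ≟ (_ ▷ _) = no λ ()
(_ ∨' _) ≟ var _ = no λ ()
(_ ∨' _) ≟ ⊥' = no λ ()
(_ ∨' _) ≟ (_ ∧' _) = no λ ()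
(a ∨' b) ≟ (c ∨' d) = map′ (λ { (refl , refl) → refl }) (λ { refl → refl , refl }) (a ≟ c ×-dec b ≟ d)
(_ ∨' _) ≟ (_ ⇒ _) = no λ ()
(_ ∨' _) ≟ (_ ▷ _) = no λ ()
(_ ⇒ _) ≟ var _ = no λ ()
(_ ⇒ _) ≟ ⊥' = no λ ()
(_ ⇒ _) ≟ (_ ∧' _) = no λ ()
(_ ⇒ _) ≟ (_ ∨' _) = no λ ()
(a ⇒ b) ≟ (c ⇒ d) = map′ (λ { (refl , refl) → refl }) (λ { refl → refl , refl }) (a ≟ c ×-dec b ≟ d)
(_ ⇒ _) ≟ (_ ▷ _) = no λ ()
(_ ▷ _) ≟ var _ = no λ ()
(_ ▷ _) ≟ ⊥' = no λ ()
(_ ▷ _) ≟ (_ ∧' _) = no λ ()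
(_ ▷ _) ≟ (_ ∨' _) = no λ ()
(_ ▷ _) ≟ (_ ⇒ _) = no λ ()
(a ▷ b) ≟ (c ▷ d) = map′ (λ { (refl , refl) → refl }) (λ { refl → refl , refl }) (a ≟ c ×-dec b ≟ d)

open import Data.List.Membership.DecPropositional _≟_ using (_∈?_)

Splitting : Set
Splitting = List Formula × List Formula

infix 3.5 _⊩_ _⊩?_

_⊩_ : Splitting → Formula → Set
w ⊩ φ = φ ∈ proj₁ w

_⊩?_ : ∀ w φ → Dec (w ⊩ φ)
w ⊩? φ = φ ∈? proj₁ w

Refutable : Splitting → Set
Refutable (t , f) = t ⊢ₘ f

asTrue asFalse : Formula → Splitting → Splitting
asTrue  φ (t , f) = φ ∷ t , f
asFalse φ (t , f) = t , φ ∷ f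

splittings : List Formula → List Splitting
splittings [] = [ ([] , []) ]
splittings (φ ∷ Ψ) = map (asTrue φ) (splittings Ψ) ++ map (asFalse φ) (splittings Ψ)

splitting-⊆ : ∀ Ψ {w} → w ∈ splittings Ψ → proj₁ w ⊆ Ψ
splitting-⊆ [] #0 ()
splitting-⊆ (φ ∷ Ψ) i j with ∈-++⁻ (map (asTrue φ) (splittings Ψ)) i
... | inj₂ i₂ with _ , i′ , refl ← ∈-map⁻ (asFalse φ) i₂ = there (splitting-⊆ Ψ i′ j)
... | inj₁ i₁ with _ , i′ , refl ← ∈-map⁻ (asTrue φ) i₁ with j
...   | #0 = #0
...   | there j′ = there (splitting-⊆ Ψ i′ j′)

splitting-total : ∀ Ψ {w φ} → w ∈ splittings Ψ → φ ∈ Ψ → φ ∈ proj₁ w ⊎ φ ∈ proj₂ w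
splitting-total (φ ∷ Ψ) i j with ∈-++⁻ (map (asTrue φ) (splittings Ψ)) i
splitting-total (φ ∷ Ψ) i j | inj₁ i₁ with _ , i′ , refl ← ∈-map⁻ (asTrue φ) i₁ with j
... | #0 = inj₁ #0
... | there j′ = [ inj₁ ∘ there , inj₂ ]′ (splitting-total Ψ i′ j′)
splitting-total (φ ∷ Ψ) i j | inj₂ i₂ with _ , i′ , refl ← ∈-map⁻ (asFalse φ) i₂ with j
... | #0 = inj₂ #0
... | there j′ = [ inj₁ , inj₂ ∘ there ]′ (splitting-total Ψ i′ j′)

-- One cut for each member of `Ψ`: the splitting with `φ` false yields `φ` as a possible disjunct,
-- and the one with `φ` true eliminates it. No excluded middle is involved.
cut-splittings : ∀ Ψ {Γ χ} → (∀ {t f} → (t , f) ∈ splittings Ψ → t ++ Γ ⊢ₘ χ ∷ f) → Γ ⊢ χ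
cut-splittings Ψ {Γ} {χ} h = go Ψ (λ i s k → h i _ _ s λ { #0 → hyp #0 ; (there j) → k j })
  where
  go : ∀ Ψ → (∀ {t f} → (t , f) ∈ splittings Ψ → ∀ {Γ′} → t ++ Γ ⊆ Γ′ →
              (∀ {δ} → δ ∈ f → δ ∷ Γ′ ⊢ χ) → Γ′ ⊢ χ) → Γ ⊢ χ
  go [] h = h #0 id λ ()
  go (φ ∷ Ψ) h = go Ψ λ i s k →
    h (∈-++⁺ʳ (map (asTrue φ) (splittings Ψ)) (∈-map⁺ (asFalse φ) i)) s λ
      { #0 → h (∈-++⁺ˡ (∈-map⁺ (asTrue φ) i))
               (λ { #0 → #0 ; (there j) → there (s j) })
               (λ j → weaken (∷⁺ʳ _ (xs⊆x∷xs _ _)) (k j))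
      ; (there j) → k j }

-- Elimination

-- In every use `B` carries a derivation. Tests therefore return positive evidence either way, and
-- derivability never has to be decided.
∀⊎ : ∀ {A B : Set} {P : A → Set} (xs : List A) →
     (∀ {x} → x ∈ xs → P x ⊎ B) → All P xs ⊎ B
∀⊎ [] h = inj₁ []
∀⊎ (x ∷ xs) h with h #0 | ∀⊎ xs (h ∘ there)
... | inj₂ b | _ = inj₂ b
... | inj₁ _ | inj₂ b = inj₂ b
... | inj₁ a | inj₁ as = inj₁ (a ∷ as)

_×⊎_ : ∀ {A B C : Set} → A ⊎ C → B ⊎ C → (A × B) ⊎ C
inj₂ c ×⊎ _      = inj₂ c
inj₁ _ ×⊎ inj₂ c = inj₂ c
inj₁ a ×⊎ inj₁ b = inj₁ (a , b)

infixr 4 _×⊎_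

data _◁_ : Formula → Formula → Set where
  ∧ˡ : ∀ {φ ψ} → φ ◁ (φ ∧' ψ)
  ∧ʳ : ∀ {φ ψ} → ψ ◁ (φ ∧' ψ)
  ∨ˡ : ∀ {φ ψ} → φ ◁ (φ ∨' ψ)
  ∨ʳ : ∀ {φ ψ} → ψ ◁ (φ ∨' ψ)
  ⇒ˡ : ∀ {φ ψ} → φ ◁ (φ ⇒ ψ)
  ⇒ʳ : ∀ {φ ψ} → ψ ◁ (φ ⇒ ψ)
  ▷ˡ : ∀ {φ ψ} → φ ◁ (φ ▷ ψ)
  ▷ʳ : ∀ {φ ψ} → ψ ◁ (φ ▷ ψ)

SubformulaClosed : List Formula → Set
SubformulaClosed Φ = ∀ {φ ψ} → φ ◁ ψ → ψ ∈ Φ → φ ∈ Φ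

module Canonical (Φ : List Formula) (closed : SubformulaClosed Φ) where

  -- Conditionals between arbitrary members of `Φ` are split too, since reflexivity, reciprocity and
  -- the witnesses for absent conditionals concern all pairs. The truth lemma is proved for `Φ`
  -- alone.
  Ψ : List Formula
  Ψ = Φ ++ cartesianProductWith _▷_ Φ Φ

  Φ⊆Ψ : Φ ⊆ Ψ
  Φ⊆Ψ = ∈-++⁺ˡ

  ▷∈Ψ : ∀ {φ ψ} → φ ∈ Φ → ψ ∈ Φ → (φ ▷ ψ) ∈ Ψ
  ▷∈Ψ i j = ∈-++⁺ʳ Φ (∈-cartesianProductWith⁺ _▷_ i j)

  Witness : List Splitting → (Splitting → Set) → Formula → Set
  Witness W P χ = ∃ λ v → v ∈ W × P v × ¬ v ⊩ χ

  -- The conditions that the truth lemma needs from the intuitionistic connectives. Conditionals are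
  -- left to the four families below, which range over all pairs or triples from `Φ` and not only
  -- over conditionals in `Φ`.
  Local : List Splitting → Splitting → Formula → Set
  Local W w (var n) = ⊤
  Local W w ⊥' = ¬ w ⊩ ⊥'
  Local W w (φ ∧' ψ) = (w ⊩ φ ∧' ψ → w ⊩ φ) × (w ⊩ φ ∧' ψ → w ⊩ ψ) × (w ⊩ φ → w ⊩ ψ → w ⊩ φ ∧' ψ)
  Local W w (φ ∨' ψ) = (w ⊩ φ ∨' ψ → w ⊩ φ ⊎ w ⊩ ψ) × (w ⊩ φ → w ⊩ φ ∨' ψ) × (w ⊩ ψ → w ⊩ φ ∨' ψ)
  Local W w (φ ⇒ ψ) = (w ⊩ φ ⇒ ψ → w ⊩ φ → w ⊩ ψ) ×
                      (w ⊩ φ ⇒ ψ ⊎ Witness W (λ v → proj₁ w ⊆ proj₁ v × v ⊩ φ) ψ)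
  Local W w (φ ▷ ψ) = ⊤

  Reflexive Detaching Reciprocal : Splitting → Set
  Reflexive  w = All (λ φ → w ⊩ φ ▷ φ) Φ
  Detaching  w = All (λ φ → All (λ ψ → w ⊩ φ → w ⊩ φ ▷ ψ → w ⊩ ψ) Φ) Φ
  Reciprocal w = All (λ φ → All (λ ψ → All (λ χ →
                   w ⊩ φ ▷ ψ → w ⊩ ψ ▷ φ → w ⊩ φ ▷ χ → w ⊩ ψ ▷ χ) Φ) Φ) Φ

  Witnessed : List Splitting → Splitting → Set
  Witnessed W w = All (λ φ → All (λ χ →
    w ⊩ φ ▷ χ ⊎ Witness W (λ v → ∀ {ψ} → ψ ∈ Φ → w ⊩ φ ▷ ψ → v ⊩ ψ) χ) Φ) Φ

  record Saturated (W : List Splitting) (w : Splitting) : Set where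
    constructor mkSaturated
    field
      locals     : All (Local W w) Φ
      reflexive  : Reflexive w
      detaching  : Detaching w
      reciprocal : Reciprocal w
      witnessed  : Witnessed W w

  Exhaustive : List Splitting → Set
  Exhaustive W = ∀ {w} → w ∈ splittings Ψ → w ∈ W ⊎ Refutable w

  module _ (W : List Splitting) (W⊆ : W ⊆ splittings Ψ) (exhaustive : Exhaustive W) where

    -- Without a witness, each splitting entails `χ` or its false part in the presence of `Γ`: a
    -- discarded one is refutable, and a remaining one has `χ` true or some member of `Γ` false. The
    -- cuts then give `Γ ⊢ χ`.
    derive-or-witness : ∀ {Γ χ} → Γ ⊆ Ψ → χ ∈ Ψ → Γ ⊢ χ ⊎ Witness W (λ v → Γ ⊆ proj₁ v) χ
    derive-or-witness {Γ} {χ} Γ⊆Ψ χ∈Ψ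
      with any? (λ v → all? (v ⊩?_) Γ ×-dec ¬? (v ⊩? χ)) W
    ... | yes a = let v , v∈W , all , χ∉v = find a in inj₂ (v , v∈W , All.lookup all , χ∉v)
    ... | no ¬a = inj₁ (cut-splittings Ψ sequent)
      where
      sequent : ∀ {t f} → (t , f) ∈ splittings Ψ → t ++ Γ ⊢ₘ χ ∷ f
      sequent {t} {f} i with exhaustive i
      ... | inj₂ refutable = ⊢ₘ-mono ∈-++⁺ˡ there refutable
      ... | inj₁ i∈W with χ ∈? t
      ...   | yes χ∈t = ⊢⇒⊢ₘ #0 (hyp (∈-++⁺ˡ χ∈t))
      ...   | no χ∉t with ∀⊎ {B = t ++ Γ ⊢ₘ χ ∷ f} Γ separate
        where
        separate : ∀ {γ} → γ ∈ Γ → γ ∈ t ⊎ (t ++ Γ ⊢ₘ χ ∷ f)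
        separate γ∈Γ = [ inj₁ , (λ γ∈f → inj₂ (⊢⇒⊢ₘ (there γ∈f) (hyp (∈-++⁺ʳ t γ∈Γ)))) ]′
                         (splitting-total Ψ i (Γ⊆Ψ γ∈Γ))
      ...     | inj₂ d = d
      ...     | inj₁ Γ⊆t = contradiction (lose i∈W (Γ⊆t , χ∉t)) ¬a

    module _ {w : Splitting} (w∈W : w ∈ W) where

      false : ∀ {φ} → φ ∈ Ψ → ¬ w ⊩ φ → φ ∈ proj₂ w
      false i n = [ (λ j → contradiction j n) , id ]′ (splitting-total Ψ (W⊆ w∈W) i)

      -- A derivable sequent violated by `w` has its left side in the true part and, by totality,
      -- its right side in the false part, so it refutes `w` by weakening.
      respects : ∀ {Γ Δ} → Γ ⊢ₘ Δ → All (_∈ Ψ) Δ → (All (w ⊩_) Γ → Any (w ⊩_) Δ) ⊎ Refutable w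
      respects {Γ} {Δ} d Δ⊆Ψ with any? (w ⊩?_) Δ | all? (w ⊩?_) Γ
      ... | yes a | _ = inj₁ (const a)
      ... | no _ | no ¬b = inj₁ (λ b → contradiction b ¬b)
      ... | no ¬a | yes b = inj₂ (⊢ₘ-mono (All.lookup b)
              (λ i → false (All.lookup Δ⊆Ψ i) (¬a ∘ lose i)) d)

      respects₁ : ∀ {Γ δ} → Γ ⊢ δ → δ ∈ Ψ → (All (w ⊩_) Γ → w ⊩ δ) ⊎ Refutable w
      respects₁ d δ∈Ψ = map₁ (λ g a → case-single (g a)) (respects (⊢⇒⊢ₘ #0 d) (δ∈Ψ ∷ []))
        where
        case-single : ∀ {δ} → Any (w ⊩_) [ δ ] → w ⊩ δ
        case-single (here a) = a

      -- Shared by `⇒` and `▷`: the argument `h` is the introduction principle, `deduction` or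
      -- `▷-closed`. If it derives a `φ` that `w` declares false, then `w` is refutable.
      decide : ∀ {φ Γ χ} → φ ∈ Ψ → Γ ⊆ Ψ → χ ∈ Ψ → (Γ ⊢ χ → proj₁ w ⊢ φ) →
               (w ⊩ φ ⊎ Witness W (λ v → Γ ⊆ proj₁ v) χ) ⊎ Refutable w
      decide {φ} φ∈Ψ Γ⊆Ψ χ∈Ψ h with w ⊩? φ | derive-or-witness Γ⊆Ψ χ∈Ψ
      ... | yes a | _ = inj₁ (inj₁ a)
      ... | no _ | inj₂ v = inj₁ (inj₂ v)
      ... | no n | inj₁ d = inj₂ (⊢⇒⊢ₘ (false φ∈Ψ n) (h d))

      local? : ∀ {χ} → χ ∈ Φ → Local W w χ ⊎ Refutable w
      local? {var n} _ = inj₁ _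
      local? {⊥'} _ = map₁ (λ g a → ⊥-elim (¬Any[] (g (a ∷ [])))) (respects ⊥-⊢ₘ [])
      local? {φ ∧' ψ} i =
        map₁ (λ g a → g (a ∷ [])) (respects₁ (∧-elimˡ (hyp #0)) (Φ⊆Ψ (closed ∧ˡ i)))
        ×⊎ map₁ (λ g a → g (a ∷ [])) (respects₁ (∧-elimʳ (hyp #0)) (Φ⊆Ψ (closed ∧ʳ i)))
        ×⊎ map₁ (λ g a b → g (a ∷ b ∷ [])) (respects₁ (∧-intro (hyp #0) (hyp #1)) (Φ⊆Ψ i))
      local? {φ ∨' ψ} i =
        map₁ (λ g a → case-pair (g (a ∷ [])))
             (respects ∨-⊢ₘ (Φ⊆Ψ (closed ∨ˡ i) ∷ Φ⊆Ψ (closed ∨ʳ i) ∷ []))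
        ×⊎ map₁ (λ g a → g (a ∷ [])) (respects₁ (axiomⁱ φ ψ ψ ∨I₁ · hyp #0) (Φ⊆Ψ i))
        ×⊎ map₁ (λ g a → g (a ∷ [])) (respects₁ (axiomⁱ φ ψ ψ ∨I₂ · hyp #0) (Φ⊆Ψ i))
        where
        case-pair : ∀ {φ ψ} → Any (w ⊩_) (φ ∷ ψ ∷ []) → w ⊩ φ ⊎ w ⊩ ψ
        case-pair (here a) = inj₁ a
        case-pair (there (here b)) = inj₂ b
      local? {φ ⇒ ψ} i =
        map₁ (λ g a b → g (a ∷ b ∷ [])) (respects₁ (hyp #0 · hyp #1) (Φ⊆Ψ (closed ⇒ʳ i)))
        ×⊎ map₁ [ inj₁ , (λ (v , v∈W , s , n) → inj₂ (v , v∈W , (s ∘ there , s #0) , n)) ]′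
             (decide (Φ⊆Ψ i)
               (λ { #0 → Φ⊆Ψ (closed ⇒ˡ i) ; (there j) → splitting-⊆ Ψ (W⊆ w∈W) j })
               (Φ⊆Ψ (closed ⇒ʳ i)) deduction)
      local? {φ ▷ ψ} _ = inj₁ _

      saturated? : Saturated W w ⊎ Refutable w
      saturated? = map₁ (λ (l , i , d , r , v) → mkSaturated l i d r v)
        (∀⊎ Φ local? ×⊎ reflexive? ×⊎ detaching? ×⊎ reciprocal? ×⊎ ∀⊎ Φ (λ i → ∀⊎ Φ (▷-dec? i)))
        where
        reflexive? : Reflexive w ⊎ Refutable w
        reflexive? = ∀⊎ Φ λ {φ} i → map₁ (λ g → g []) (respects₁ (axiomᶜ φ φ φ id▷) (▷∈Ψ i i))

        detaching? : Detaching w ⊎ Refutable w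
        detaching? = ∀⊎ Φ λ {φ} i → ∀⊎ Φ λ {ψ} j →
          map₁ (λ g a b → g (a ∷ b ∷ []))
            (respects₁ (axiomᶜ φ ψ ψ mpC · ∧-intro (hyp #0) (hyp #1)) (Φ⊆Ψ j))

        reciprocal? : Reciprocal w ⊎ Refutable w
        reciprocal? = ∀⊎ Φ λ i → ∀⊎ Φ λ j → ∀⊎ Φ λ k →
          map₁ (λ g a b c → g (a ∷ b ∷ c ∷ []))
            (respects₁ (▷-reciprocity (hyp #0) (hyp #1) (hyp #2)) (▷∈Ψ j k))

        ▷-dec? : ∀ {φ χ} → φ ∈ Φ → χ ∈ Φ →
                 (w ⊩ φ ▷ χ ⊎ Witness W (λ v → ∀ {ψ} → ψ ∈ Φ → w ⊩ φ ▷ ψ → v ⊩ ψ) χ) ⊎ Refutable w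
        ▷-dec? {φ} i j = map₁
          [ inj₁ , (λ (v , v∈W , s , n) → inj₂ (v , v∈W , (λ k a → s (∈-filter⁺ sel? k a)) , n)) ]′
          -- The context consists of all `ψ` in `Φ` with `φ ▷ ψ` true at `w`, so a witness is
          -- exactly a splitting selected by `φ` at `w` that omits `χ`.
          (decide (▷∈Ψ i j) (λ k → Φ⊆Ψ (proj₁ (∈-filter⁻ sel? {xs = Φ} k))) (Φ⊆Ψ j)
            (▷-closed (filter sel? Φ) (λ k → hyp (proj₂ (∈-filter⁻ sel? {xs = Φ} k)))))
          where
          sel? : ∀ ψ → Dec (w ⊩ φ ▷ ψ)
          sel? ψ = w ⊩? φ ▷ ψ

  record Elimination : Set where
    field
      worlds     : List Splitting
      worlds⊆    : worlds ⊆ splittings Ψ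
      exhaustive : Exhaustive worlds
      saturated  : ∀ {w} → w ∈ worlds → Saturated worlds w

  eliminate : Elimination
  eliminate = go (length (splittings Ψ)) (splittings Ψ) ℕ.≤-refl id inj₁
    where
    ∈-─ : ∀ {A : Set} {xs : List A} {x y : A} (i : x ∈ xs) → y ∈ xs → y ≡ x ⊎ y ∈ (xs ─ i)
    ∈-─ #0 #0 = inj₁ refl
    ∈-─ #0 (there j) = inj₂ j
    ∈-─ (there i) #0 = inj₂ #0
    ∈-─ (there i) (there j) = [ inj₁ , inj₂ ∘ there ]′ (∈-─ i j)

    ─-⊆ : ∀ {A : Set} {xs : List A} {x : A} (i : x ∈ xs) → (xs ─ i) ⊆ xs
    ─-⊆ #0 j = there j
    ─-⊆ (there i) #0 = #0
    ─-⊆ (there i) (there j) = there (─-⊆ i j)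

    length-─ : ∀ {A : Set} {xs : List A} {x : A} (i : x ∈ xs) → length xs ≡ suc (length (xs ─ i))
    length-─ #0 = refl
    length-─ (there i) = cong suc (length-─ i)

    -- The number `n` bounds the rounds left. A removal may destroy witnesses used by other
    -- splittings, so every survivor is tested afresh.
    go : ∀ n W → length W ≤ n → W ⊆ splittings Ψ → Exhaustive W → Elimination
    go n W len W⊆ ex with ∀⊎ {B = ∃ λ w → w ∈ W × Refutable w} W
                             (λ i → map₂ (λ d → _ , i , d) (saturated? W W⊆ ex i))
    ... | inj₁ sat = record { worlds = W ; worlds⊆ = W⊆ ; exhaustive = ex ; saturated = All.lookup sat }
    go zero (_ ∷ _) () W⊆ ex | inj₂ _
    go (suc n) W len W⊆ ex | inj₂ (w , i , d) =
      go n (W ─ i) (s≤s⁻¹ (subst (_≤ suc n) (length-─ i) len)) (W⊆ ∘ ─-⊆ i)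
         (λ j → [ (λ k → [ (λ { refl → inj₂ d }) , inj₁ ]′ (∈-─ i k)) , inj₂ ]′ (ex j))

  -- Countermodel

  module Model (W : List Splitting) (saturated : ∀ {w} → w ∈ W → Saturated W w) where

    World : Set
    World = ∃ λ w → w ∈ W

    infix 3.5 _∋_ _≼_

    _∋_ : World → Formula → Set
    x ∋ φ = proj₁ x ⊩ φ

    _≼_ : World → World → Set
    x ≼ y = ∀ {φ} → x ∋ φ → y ∋ φ

    Sel : World → Formula → World → Set
    Sel x φ y = ∀ {ψ} → ψ ∈ Φ → x ∋ φ ▷ ψ → y ∋ ψ

    module _ (x : World) where
      open Saturated (saturated (proj₂ x))

      local : ∀ {χ} → χ ∈ Φ → Local W (proj₁ x) χ
      local = All.lookup locals

      ▷-refl : ∀ {φ} → φ ∈ Φ → x ∋ φ ▷ φ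
      ▷-refl = All.lookup reflexive

      ▷-mp : ∀ {φ ψ} → φ ∈ Φ → ψ ∈ Φ → x ∋ φ → x ∋ φ ▷ ψ → x ∋ ψ
      ▷-mp i = All.lookup (All.lookup detaching i)

      ▷-recip : ∀ {φ ψ χ} → φ ∈ Φ → ψ ∈ Φ → χ ∈ Φ →
                x ∋ φ ▷ ψ → x ∋ ψ ▷ φ → x ∋ φ ▷ χ → x ∋ ψ ▷ χ
      ▷-recip i j = All.lookup (All.lookup (All.lookup reciprocal i) j)

    -- Were `φ ▷ ψ` absent, `Witnessed` would supply a world selected by `φ` at `x` that omits `ψ`.
    Sel-⊆⇒▷ : ∀ x {φ ψ} → φ ∈ Φ → ψ ∈ Φ → (∀ z → Sel x φ z → z ∋ ψ) → x ∋ φ ▷ ψ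
    Sel-⊆⇒▷ x i j h with All.lookup (All.lookup (Saturated.witnessed (saturated (proj₂ x))) i) j
    ... | inj₁ a = a
    ... | inj₂ (v , v∈W , s , n) = contradiction (h (v , v∈W) s) n

    Approx : (World → Set) → World → Formula → Set
    Approx a x φ = (∀ z → Sel x φ z → a z) × (∀ z → a z → z ∋ φ)

    -- From `Sel x ψ ⊆ a ⊆ [φ]` comes `ψ ▷ φ` at `x`, and symmetrically `φ ▷ ψ`; reciprocity then
    -- transfers consequents.
    Approx-unique : ∀ {a} x {φ ψ y} → φ ∈ Φ → ψ ∈ Φ → Approx a x φ → Approx a x ψ →
                    Sel x φ y → Sel x ψ y
    Approx-unique x i j (φ⊆a , a⊆φ) (ψ⊆a , a⊆ψ) s k ψ▷χ =
      s k (▷-recip x j i k (Sel-⊆⇒▷ x j i (λ z → a⊆φ z ∘ ψ⊆a z))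
                           (Sel-⊆⇒▷ x i j (λ z → a⊆ψ z ∘ φ⊆a z)) ψ▷χ)

    -- Quantifying over all approximations avoids deciding whether one exists. If one does, the
    -- relation is its `Sel`; if none does, it is all of `a`.
    Rel : (World → Set) → World → World → Set
    Rel a x y = a y × (∀ {φ} → φ ∈ Φ → Approx a x φ → Sel x φ y)

    Sel⇒Rel : ∀ {a} x {φ y} → φ ∈ Φ → Approx a x φ → Sel x φ y → Rel a x y
    Sel⇒Rel x {y = y} i ap s = proj₁ ap y s , λ j aq → Approx-unique x {y = y} i j ap aq s

    -- A larger world has more conditionals and so a smaller `Sel`. Hence an approximation at `x` is
    -- also one at `y`, and `y` imposes at least the constraints of `x`.
    Rel-back : ∀ {a x y z} → x ≼ y → Rel a y z → Rel a x z
    Rel-back x≼y (az , h) = az , λ i (φ⊆a , a⊆φ) k a →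
      h i ((λ w s → φ⊆a w (λ j b → s j (x≼y b))) , a⊆φ) k (x≼y a)

    frame : World → Frame 0ℓ
    frame x₀ = record
      { Carrier = World
      ; point   = x₀
      ; _≤_     = _≼_
      ; ≤-refl  = λ _ → id
      ; ≤-trans = λ x≼y y≼z → y≼z ∘ x≼y
      ; R       = Rel ∘ proj₁
      ; R-ext   = λ a b a⊆b b⊆a x y (ay , h) → a⊆b y ay , λ i (φ⊆b , b⊆φ) →
                    h i ((λ z → b⊆a z ∘ φ⊆b z) , (λ z → b⊆φ z ∘ a⊆b z))
      ; R-back  = λ a {x} {y} {z} x≼y yRz → z , Rel-back {proj₁ a} {x} {y} {z} x≼y yRz , id
      }

    -- Membership in Sel x φ is stable under double negation, so we may
    -- distinguish whether a has an approximation ψ at x: if so, Rel a x is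
    -- Sel x ψ and ψ also approximates b; if not, Rel a x is a, hence a = b.
    Rel-shrink : ∀ {a b : World → Set} x → (∀ z → Rel a x z → b z) → (∀ z → b z → a z) →
                 ∀ {y} → Rel a x y → Rel b x y
    Rel-shrink {a} {b} x Rel⊆b b⊆a {y} (ay , h) = Rel⊆b y (ay , h) , selected
      where
      selected : ∀ {φ} → φ ∈ Φ → Approx b x φ → Sel x φ y
      selected {φ} i (φ⊆b , b⊆φ) {χ} k φ▷χ = decidable-stable (proj₁ y ⊩? χ) λ ¬χ →
        let unapproximable : ∀ {ψ} → ψ ∈ Φ → ¬ Approx a x ψ
            unapproximable j ap = ¬χ (Approx-unique {b} x {y = y} j i
              ((λ z s → Rel⊆b z (Sel⇒Rel x j ap s)) , λ z → proj₂ ap z ∘ b⊆a z)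
              (φ⊆b , b⊆φ) (h j ap) k φ▷χ)
            a⊆b : ∀ z → a z → b z
            a⊆b z az = Rel⊆b z (az , λ j ap → contradiction ap (unapproximable j))
        in unapproximable i ((λ z → b⊆a z ∘ φ⊆b z) , λ z → b⊆φ z ∘ a⊆b z)

    -- An approximation of `a` also approximates `b`: its `Sel` lies in `Rel a x`, hence in `b`, and
    -- `b` lies in `a`. So `b` is at least as constrained as `a`.
    Rel-expand : ∀ {a b : World → Set} x → (∀ z → Rel a x z → b z) → (∀ z → b z → a z) →
                 ∀ {y} → Rel b x y → Rel a x y
    Rel-expand x Rel⊆b b⊆a {y} (by , h) = b⊆a y by , λ i ap →
      h i ((λ z s → Rel⊆b z (Sel⇒Rel x i ap s)) , λ z → proj₂ ap z ∘ b⊆a z)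

    -- This makes `↑R_a[x]` equal to `R_a[x]`, which reduces cautiousness to the two inclusions
    -- above.
    Rel-upset : ∀ {a : World → Set} x → IsUpset _≼_ a → IsUpset _≼_ (Rel a x)
    Rel-upset x up {y} {z} y≼z (ay , h) =
      up {y} {z} y≼z ay , λ i ap k φ▷ψ → y≼z (h i ap k φ▷ψ)

    frame-cautious : ∀ x₀ → Cautious (frame x₀)
    frame-cautious x₀ = (λ _ _ _ → proj₁) , λ (a , a↑) (b , b↑) x Rel⊆b b⊆a →
      (λ y (s , xRs , s≼y) → y , Rel-upset x b↑ {s} {y} s≼y (Rel-shrink x Rel⊆b b⊆a {s} xRs) , id) ,
      (λ y (s , xRs , s≼y) → y , Rel-upset x a↑ {s} {y} s≼y (Rel-expand x Rel⊆b b⊆a {s} xRs) , id)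

    frame-centring : ∀ x₀ → CentringUp (frame x₀)
    -- The world `x` is its own successor: each approximation `φ` of `a` is true at `x`, and
    -- detachment makes the consequents of its conditionals true there.
    frame-centring x₀ a x ax = x , (ax , λ i (_ , a⊆φ) k → ▷-mp x i k (a⊆φ x ax)) , id

    module _ (x₀ : World) where

      valuation : Valuation (frame x₀)
      valuation n = (_∋ var n) , λ x≼y → x≼y

      _⊨_ : World → Formula → Set
      x ⊨ φ = sat (frame x₀) valuation φ x

      mutual
        ⊨⇒∋ : ∀ φ → φ ∈ Φ → ∀ x → x ⊨ φ → x ∋ φ
        ⊨⇒∋ (var n) i x h = h
        ⊨⇒∋ (φ ∧' ψ) i x (a , b) =
          proj₂ (proj₂ (local x i)) (⊨⇒∋ φ (closed ∧ˡ i) x a) (⊨⇒∋ ψ (closed ∧ʳ i) x b)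
        ⊨⇒∋ (φ ∨' ψ) i x (inj₁ a) = proj₁ (proj₂ (local x i)) (⊨⇒∋ φ (closed ∨ˡ i) x a)
        ⊨⇒∋ (φ ∨' ψ) i x (inj₂ b) = proj₂ (proj₂ (local x i)) (⊨⇒∋ ψ (closed ∨ʳ i) x b)
        ⊨⇒∋ (φ ⇒ ψ) i x h with proj₂ (local x i)
        ... | inj₁ a = a
        ... | inj₂ (v , v∈W , (x≼v , v⊩φ) , v⊮ψ) =
          contradiction (⊨⇒∋ ψ (closed ⇒ʳ i) y (h y x≼v (∋⇒⊨ φ (closed ⇒ˡ i) y v⊩φ))) v⊮ψ
          where
          y : World
          y = v , v∈W
        -- The truth set of `φ` is approximated by `φ` itself, so every world in `Sel x φ` is a
        -- successor to which `h` applies.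
        ⊨⇒∋ (φ ▷ ψ) i x h = Sel-⊆⇒▷ x iφ iψ λ z s →
          ⊨⇒∋ ψ iψ z (h z (Sel⇒Rel x iφ (⊨-Approx φ iφ x) s))
          where
          iφ = closed ▷ˡ i
          iψ = closed ▷ʳ i

        ∋⇒⊨ : ∀ φ → φ ∈ Φ → ∀ x → x ∋ φ → x ⊨ φ
        ∋⇒⊨ (var n) i x a = a
        ∋⇒⊨ ⊥' i x a = ⊥-elim (local x i a)
        ∋⇒⊨ (φ ∧' ψ) i x a =
          ∋⇒⊨ φ (closed ∧ˡ i) x (proj₁ (local x i) a) ,
          ∋⇒⊨ ψ (closed ∧ʳ i) x (proj₁ (proj₂ (local x i)) a)
        ∋⇒⊨ (φ ∨' ψ) i x a =
          [ inj₁ ∘ ∋⇒⊨ φ (closed ∨ˡ i) x , inj₂ ∘ ∋⇒⊨ ψ (closed ∨ʳ i) x ]′ (proj₁ (local x i) a)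
        ∋⇒⊨ (φ ⇒ ψ) i x a y x≼y h =
          ∋⇒⊨ ψ (closed ⇒ʳ i) y (proj₁ (local y i) (x≼y a) (⊨⇒∋ φ (closed ⇒ˡ i) y h))
        ∋⇒⊨ (φ ▷ ψ) i x a y (_ , h) =
          ∋⇒⊨ ψ (closed ▷ʳ i) y (h iφ (⊨-Approx φ iφ x) (closed ▷ʳ i) a)
          where
          iφ = closed ▷ˡ i

        -- The truth lemma for `φ` identifies its truth set with `[φ]`, and `φ ▷ φ` at `x` keeps
        -- `Sel x φ` inside it.
        ⊨-Approx : ∀ φ → φ ∈ Φ → ∀ x → Approx (_⊨ φ) x φ
        ⊨-Approx φ i x = (λ z s → ∋⇒⊨ φ i z (s i (▷-refl x i))) , ⊨⇒∋ φ i

-- Subformula closure and completeness.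

subformulas : Formula → List Formula
subformulas φ@(var _)  = [ φ ]
subformulas φ@⊥'       = [ φ ]
subformulas φ@(α ∧' β) = φ ∷ subformulas α ++ subformulas β
subformulas φ@(α ∨' β) = φ ∷ subformulas α ++ subformulas β
subformulas φ@(α ⇒ β)  = φ ∷ subformulas α ++ subformulas β
subformulas φ@(α ▷ β)  = φ ∷ subformulas α ++ subformulas β

∈-subformulas : ∀ φ → φ ∈ subformulas φ
∈-subformulas (var _)  = #0
∈-subformulas ⊥'       = #0
∈-subformulas (_ ∧' _) = #0
∈-subformulas (_ ∨' _) = #0
∈-subformulas (_ ⇒ _)  = #0
∈-subformulas (_ ▷ _)  = #0

subformulas-closed : ∀ φ → SubformulaClosed (subformulas φ)
subformulas-closed = go
  where
  left : ∀ α β → α ∈ subformulas α ++ subformulas β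
  left α β = ∈-++⁺ˡ (∈-subformulas α)

  right : ∀ α β → β ∈ subformulas α ++ subformulas β
  right α β = ∈-++⁺ʳ (subformulas α) (∈-subformulas β)

  go : ∀ φ → SubformulaClosed (subformulas φ)
  both : ∀ α β → SubformulaClosed (subformulas α ++ subformulas β)
  both α β c i = [ ∈-++⁺ˡ ∘ go α c , ∈-++⁺ʳ (subformulas α) ∘ go β c ]′ (∈-++⁻ (subformulas α) i)
  go (var _) () #0
  go ⊥' () #0
  go (α ∧' β) ∧ˡ #0 = there (left α β)
  go (α ∧' β) ∧ʳ #0 = there (right α β)
  go (α ∧' β) c (there i) = there (both α β c i)
  go (α ∨' β) ∨ˡ #0 = there (left α β)
  go (α ∨' β) ∨ʳ #0 = there (right α β)
  go (α ∨' β) c (there i) = there (both α β c i)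
  go (α ⇒ β) ⇒ˡ #0 = there (left α β)
  go (α ⇒ β) ⇒ʳ #0 = there (right α β)
  go (α ⇒ β) c (there i) = there (both α β c i)
  go (α ▷ β) ▷ˡ #0 = there (left α β)
  go (α ▷ β) ▷ʳ #0 = there (right α β)
  go (α ▷ β) c (there i) = there (both α β c i)

completeness : ∀ {φ} → ValidClass 0ℓ φ → iCC+MP φ
completeness {φ} valid
  -- With the empty context, the alternative to a derivation of `φ` is a surviving splitting that
  -- omits `φ`, and this becomes the refuting world.
  with derive-or-witness worlds worlds⊆ exhaustive {Γ = []} {φ} (λ ()) (Φ⊆Ψ (∈-subformulas φ))
  where
  open Canonical (subformulas φ) (subformulas-closed φ)
  open Elimination eliminate
... | inj₁ d = []⊢⇒theorem d
... | inj₂ (w , w∈W , _ , w⊮φ) =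
  contradiction
    (⊨⇒∋ x φ (∈-subformulas φ) x (valid (frame x) (frame-cautious x) (frame-centring x) (valuation x) x))
    w⊮φ
  where
  open Canonical (subformulas φ) (subformulas-closed φ)
  open Elimination eliminate
  open Model worlds saturated
  x : World
  x = w , w∈W

theorem6p10 : SoundAndComplete iCC+MP
theorem6p10 = record
  { sound    = λ d ℓ F cautious centring → soundness F cautious centring d
  ; complete = λ valid → completeness (valid 0ℓ)
  }
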